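{- Let $p/q$ be a rational number in lowest terms with $q\ge 1$, let $m\ge 0$ be an integer, and let $(u_n)_{n\ge1}$ be an arbitrary sequence of positive integers. Write $p/q=[a_0;a_1,\dots,a_{2k}]$ as a finite continued fraction whose last partial quotient has even index $2k$, $k\ge 0$, and let $q_{2k-1}$ be the denominator of its $(2k-1)$th convergent. Set $$y_0=mq+q_{2k-1}+1,\qquad x_1=q,$$ and define $(y_n)_{n\ge 0}$, $(x_n)_{n\ge 1}$ by $$y_j=y_{j-1}(1+u_jx_j),\qquad x_{j+1}=x_jy_j,\qquad j\ge 1.$$ Let $$\alpha=\frac pq+\sum_{j=2}^\infty\frac1{x_j}.$$ Then the continued fraction expansion of $\alpha$ is the infinite continued fraction $\alpha=[a_0;a_1,a_2,\dots]$, where $a_0,\dots,a_{2k}$ are the partial quotients of the expansion $p/q=[a_0;a_1,\dots,a_{2k}]$, and $$a_{2k+1}=m+u_1y_0,\qquad a_{2k+2j}=x_j,\qquad a_{2k+2j+1}=u_{j+1}y_j\qquad\text{for all } j\ge 1.$$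
   Context: Continued fractions: $[a_0;a_1,\dots,a_n]=a_0+\cfrac{1}{a_1+\cfrac{1}{\cdots+\cfrac1{a_n}}}$ with $a_0\in\mathbb Z$ and $a_j\in\mathbb Z_{>0}$ for $j\ge1$, and $[a_0;a_1,a_2,\dots]=\lim_{n\to\infty}[a_0;a_1,\dots,a_n]$. Convergents $p_n/q_n=[a_0;\dots,a_n]$ are given by $p_{n+1}=a_{n+1}p_n+p_{n-1}$, $q_{n+1}=a_{n+1}q_n+q_{n-1}$ for $n\ge -1$, with $p_{ -1}=1$, $p_{ -2}=0$, $q_{ -1}=0$, $q_{ -2}=1$. Every rational number has a finite continued fraction whose last index is even, because $[a_0;\dots,a_j]=[a_0;\dots,a_j-1,1]$ if $j=0$ or $a_j>1$, and $[a_0;\dots,a_{j-1},1]=[a_0;\dots,a_{j-1}+1]$. -}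

module Defs where

open import Data.Nat as ℕ using (ℕ; zero; suc)
open import Data.Integer as ℤ using (ℤ; 0ℤ; 1ℤ)
open import Data.Rational as ℚ using (ℚ; 0ℚ; _/_; 1/_; ∣_∣)
open import Data.Rational.Properties using (_≟_)
open import Data.Product using (_×_; ∃-syntax)
open import Function using (_∘_)
open import Relation.Nullary using (yes; no)

-- Real numbers as Cauchy sequences of rationals.  Equality of reals is not
-- needed: reals are only referred to as limits of rational sequences.
record ℝ : Set where
  field
    approx : ℕ → ℚ
    cauchy : ∀ ε → 0ℚ ℚ.< ε → ∃[ N ] (∀ m n → N ℕ.≤ m → N ℕ.≤ n →
               ∣ approx m ℚ.- approx n ∣ ℚ.< ε)

open ℝ public

-- s ⟶ x : the rational sequence s converges to the real x.  The inner clause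
-- "∣ s n - approx x i ∣ < ε for all large i" lies between ∣ s n - x ∣ < ε and
-- ∣ s n - x ∣ ≤ ε, hence gives the usual limit once ε is quantified over.
infix 4 _⟶_
_⟶_ : (ℕ → ℚ) → ℝ → Set
s ⟶ x = ∀ ε → 0ℚ ℚ.< ε → ∃[ N ] (∀ n → N ℕ.≤ n →
          ∃[ I ] (∀ i → I ℕ.≤ i → ∣ s n ℚ.- approx x i ∣ ℚ.< ε))

fromℤ : ℤ → ℚ
fromℤ i = i / 1

-- Totalised reciprocal; the value at 0 is a dummy, only ever relevant outside
-- the positivity conditions on partial quotients.
recip : ℚ → ℚ
recip r with r ≟ 0ℚ
... | yes _   = 0ℚ
... | no  r≢0 = 1/_ r {{ℚ.≢-nonZero r≢0}}

-- ∑< n f = f 0 + … + f (n - 1)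
∑< : ℕ → (ℕ → ℚ) → ℚ
∑< zero    f = 0ℚ
∑< (suc n) f = ∑< n f ℚ.+ f n

-- cf a n = [a₀; a₁, …, aₙ]; only the first n + 1 terms of a matter, so a finite
-- continued fraction is given by a sequence together with its last index.
cf : (ℕ → ℤ) → ℕ → ℚ
cf a zero    = fromℤ (a 0)
cf a (suc n) = fromℤ (a 0) ℚ.+ recip (cf (a ∘ suc) n)

-- Denominators of convergents, with the index shifted by two so as to start
-- from q₋₂ = 1, q₋₁ = 0:  den a i = q_{i-2}, which depends on a₀, …, a_{i-2}.
den : (ℕ → ℤ) → ℕ → ℤ
den a zero          = 1ℤ
den a (suc zero)    = 0ℤ
den a (suc (suc i)) = a i ℤ.* den a (suc i) ℤ.+ den a i

-- The continued fraction expansion of x is [a₀; a₁, a₂, …].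
HasExpansion : ℝ → (ℕ → ℤ) → Set
HasExpansion x a = (∀ j → 1 ℕ.≤ j → 0ℤ ℤ.< a j) × (cf a ⟶ x)

{-# OPTIONS --safe #-}

-- By induction on j the denominators of the convergents of a satisfy
-- q_{2k+2j} = x_{j+1} and q_{2k+2j+1} = y_{j+1} − 1.  Convergents with even
-- indices n and n + 2 differ by a_{n+2} / (q_n q_{n+2}), which for n = 2k + 2j
-- is 1 / x_{j+2}; so the convergents of index 2k, 2k + 2, … are exactly the
-- partial sums of the series for α.  The convergent of index 2k + 2j + 1 exceeds
-- its predecessor by 1 / (q_{2k+2j} q_{2k+2j+1}) ≤ 1 / x_{j+1}.  Since
-- x_{j+2} ≥ 2 x_{j+1}, these gaps tend to 0, the j-th partial sum is increasing in
-- j, and its sum with 1 / x_{j+1} is decreasing, which gives convergence.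
module Submission where

open import Data.Nat as ℕ using (ℕ; zero; suc; NonZero)
import Data.Nat.Divisibility as ℕ
import Data.Nat.Properties as ℕ
open import Data.Integer as ℤ using (ℤ; +_; 0ℤ; 1ℤ; _+_; _*_; _<_; _≤_)
import Data.Integer.Coprimality as ℤ
open import Data.Integer.Coprimality using (Coprime)
open import Data.Integer.Divisibility using (_∣_)
import Data.Integer.Divisibility.Signed as Signed
import Data.Integer.Properties as ℤ
import Data.Integer.Tactic.RingSolver as ℤ-Solver
open import Data.Product using (_×_; _,_; ∃-syntax; proj₁; proj₂)
open import Data.Rational as ℚ using (ℚ; 0ℚ; 1ℚ; ½; _/_; ∣_∣; ↥_; ↧_; ↧ₙ_)
import Data.Rational.Properties as ℚ
import Data.Rational.Unnormalised as ℚᵘ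
import Data.Rational.Unnormalised.Properties as ℚᵘ
open import Data.Sum using (_⊎_; inj₁; inj₂)
open import Function using (_∘_)
open import Level using (0ℓ)
open import Relation.Binary.PropositionalEquality
  using (_≡_; refl; sym; trans; cong; cong₂; subst; subst₂; module ≡-Reasoning)
open import Relation.Nullary using (yes; no; contradiction; dec⇒maybe)
open import Tactic.RingSolver using (solve-∀)
open import Tactic.RingSolver.Core.AlmostCommutativeRing as ACR using (AlmostCommutativeRing)
open import Defs

-- The embedding of the integers in the rationals.

ℚ-ring : AlmostCommutativeRing 0ℓ 0ℓ
ℚ-ring = ACR.fromCommutativeRing ℚ.+-*-commutativeRing (λ p → dec⇒maybe (0ℚ ℚ.≟ p))

-- `i / 1` passes through normalisation, so identities about `fromℤ` are transported to unnormalised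
-- fractions with denominator 1, where they become integer identities.
toℚᵘ-fromℤ : ∀ i → ℚ.toℚᵘ (fromℤ i) ℚᵘ.≃ ℚᵘ.mkℚᵘ i 0
toℚᵘ-fromℤ i = ℚ.toℚᵘ-fromℚᵘ (ℚᵘ.mkℚᵘ i 0)

fromℤ-+ : ∀ i j → fromℤ (i + j) ≡ fromℤ i ℚ.+ fromℤ j
fromℤ-+ i j = ℚ.toℚᵘ-injective (begin
  ℚ.toℚᵘ (fromℤ (i + j))                       ≈⟨ toℚᵘ-fromℤ (i + j) ⟩
  ℚᵘ.mkℚᵘ (i + j) 0                            ≈⟨ ℚᵘ.*≡* (lemma i j) ⟩
  ℚᵘ.mkℚᵘ i 0 ℚᵘ.+ ℚᵘ.mkℚᵘ j 0                 ≈⟨ ℚᵘ.+-cong (toℚᵘ-fromℤ i) (toℚᵘ-fromℤ j) ⟨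
  ℚ.toℚᵘ (fromℤ i) ℚᵘ.+ ℚ.toℚᵘ (fromℤ j)       ≈⟨ ℚ.toℚᵘ-homo-+ (fromℤ i) (fromℤ j) ⟨
  ℚ.toℚᵘ (fromℤ i ℚ.+ fromℤ j)                 ∎)
  where
  open ℚᵘ.≃-Reasoning
  lemma : ∀ i j → (i + j) * 1ℤ ≡ (i * 1ℤ + j * 1ℤ) * 1ℤ
  lemma = ℤ-Solver.solve-∀

fromℤ-* : ∀ i j → fromℤ (i * j) ≡ fromℤ i ℚ.* fromℤ j
fromℤ-* i j = ℚ.toℚᵘ-injective (begin
  ℚ.toℚᵘ (fromℤ (i * j))                       ≈⟨ toℚᵘ-fromℤ (i * j) ⟩
  ℚᵘ.mkℚᵘ i 0 ℚᵘ.* ℚᵘ.mkℚᵘ j 0                 ≈⟨ ℚᵘ.*-cong (toℚᵘ-fromℤ i) (toℚᵘ-fromℤ j) ⟨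
  ℚ.toℚᵘ (fromℤ i) ℚᵘ.* ℚ.toℚᵘ (fromℤ j)       ≈⟨ ℚ.toℚᵘ-homo-* (fromℤ i) (fromℤ j) ⟨
  ℚ.toℚᵘ (fromℤ i ℚ.* fromℤ j)                 ∎)
  where open ℚᵘ.≃-Reasoning

fromℤ-neg : ∀ i → fromℤ (ℤ.- i) ≡ ℚ.- fromℤ i
fromℤ-neg i = begin
  fromℤ (ℤ.- i)                                      ≡⟨ lemma (fromℤ (ℤ.- i)) (fromℤ i) ⟩
  fromℤ (ℤ.- i) ℚ.+ fromℤ i ℚ.- fromℤ i              ≡⟨ cong (ℚ._- fromℤ i) (fromℤ-+ (ℤ.- i) i) ⟨
  fromℤ (ℤ.- i + i) ℚ.- fromℤ i                      ≡⟨ cong (λ z → fromℤ z ℚ.- fromℤ i) (ℤ.+-inverseˡ i) ⟩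
  0ℚ ℚ.- fromℤ i                                     ≡⟨ ℚ.+-identityˡ _ ⟩
  ℚ.- fromℤ i                                        ∎
  where
  open ≡-Reasoning
  lemma : ∀ x y → x ≡ x ℚ.+ y ℚ.- y
  lemma = solve-∀ ℚ-ring

fromℤ-injective : ∀ {i j} → fromℤ i ≡ fromℤ j → i ≡ j
fromℤ-injective {i} {j} eq with ℚᵘ.≃-trans (ℚᵘ.≃-sym (toℚᵘ-fromℤ i)) (ℚᵘ.≃-trans (ℚᵘ.≃-reflexive (cong ℚ.toℚᵘ eq)) (toℚᵘ-fromℤ j))
... | ℚᵘ.*≡* i1≡j1 = ℤ.*-cancelʳ-≡ i j 1ℤ i1≡j1

fromℤ-mono-< : ∀ {i j} → i < j → fromℤ i ℚ.< fromℤ j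
fromℤ-mono-< {i} {j} i<j = ℚ.toℚᵘ-cancel-<
  (ℚᵘ.<-respˡ-≃ (ℚᵘ.≃-sym (toℚᵘ-fromℤ i)) (ℚᵘ.<-respʳ-≃ (ℚᵘ.≃-sym (toℚᵘ-fromℤ j))
    (ℚᵘ.*<* (ℤ.*-monoʳ-<-pos 1ℤ i<j))))

fromℤ-mono-≤ : ∀ {i j} → i ≤ j → fromℤ i ℚ.≤ fromℤ j
fromℤ-mono-≤ {i} {j} i≤j = ℚ.toℚᵘ-cancel-≤
  (ℚᵘ.≤-respˡ-≃ (ℚᵘ.≃-sym (toℚᵘ-fromℤ i)) (ℚᵘ.≤-respʳ-≃ (ℚᵘ.≃-sym (toℚᵘ-fromℤ j))
    (ℚᵘ.*≤* (ℤ.*-monoʳ-≤-nonNeg 1ℤ i≤j))))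

-- Reciprocals of positive rationals and integers.

recip-inverse : ∀ {x} → 0ℚ ℚ.< x → x ℚ.* recip x ≡ 1ℚ
recip-inverse {x} 0<x with x ℚ.≟ 0ℚ
... | yes x≡0 = contradiction (sym x≡0) (ℚ.<⇒≢ 0<x)
... | no  x≢0 = ℚ.*-inverseʳ x {{ℚ.≢-nonZero x≢0}}

recip-unique : ∀ {x r} → 0ℚ ℚ.< x → x ℚ.* r ≡ 1ℚ → recip x ≡ r
recip-unique {x} {r} 0<x xr≡1 = begin
  recip x                      ≡⟨ ℚ.*-identityʳ _ ⟨
  recip x ℚ.* 1ℚ               ≡⟨ cong (recip x ℚ.*_) xr≡1 ⟨
  recip x ℚ.* (x ℚ.* r)        ≡⟨ lemma (recip x) x r ⟩
  x ℚ.* recip x ℚ.* r          ≡⟨ cong (ℚ._* r) (recip-inverse 0<x) ⟩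
  1ℚ ℚ.* r                     ≡⟨ ℚ.*-identityˡ r ⟩
  r                            ∎
  where
  open ≡-Reasoning
  lemma : ∀ s x r → s ℚ.* (x ℚ.* r) ≡ x ℚ.* s ℚ.* r
  lemma = solve-∀ ℚ-ring

recip-positive : ∀ {x} → 0ℚ ℚ.< x → 0ℚ ℚ.< recip x
recip-positive {x} 0<x with x ℚ.≟ 0ℚ
... | yes x≡0 = contradiction (sym x≡0) (ℚ.<⇒≢ 0<x)
... | no  x≢0 = ℚ.positive⁻¹ _ {{ℚ.1/pos⇒pos x {{ℚ.positive 0<x}}}}

ρ : ℤ → ℚ
ρ i = recip (fromℤ i)

ρ-inverse : ∀ {i} → 0ℤ < i → fromℤ i ℚ.* ρ i ≡ 1ℚ
ρ-inverse 0<i = recip-inverse (fromℤ-mono-< 0<i)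

ρ-positive : ∀ {i} → 0ℤ < i → 0ℚ ℚ.< ρ i
ρ-positive 0<i = recip-positive (fromℤ-mono-< 0<i)

ρ-unique : ∀ {i r} → 0ℤ < i → fromℤ i ℚ.* r ≡ 1ℚ → ρ i ≡ r
ρ-unique 0<i = recip-unique (fromℤ-mono-< 0<i)

*-positive : ∀ {i j} → 0ℤ < i → 0ℤ < j → 0ℤ < i * j
*-positive {i} {j} 0<i 0<j =
  subst (_< i * j) (ℤ.*-zeroʳ i) (ℤ.*-monoˡ-<-pos i {{ℤ.positive 0<i}} 0<j)

*-nonNegative : ∀ {i j} → 0ℤ ≤ i → 0ℤ ≤ j → 0ℤ ≤ i * j
*-nonNegative {i} {j} 0≤i 0≤j =
  subst (_≤ i * j) (ℤ.*-zeroʳ i) (ℤ.*-monoˡ-≤-nonNeg i {{ℤ.nonNegative 0≤i}} 0≤j)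

ℚ-*-positive : ∀ {p q} → 0ℚ ℚ.< p → 0ℚ ℚ.< q → 0ℚ ℚ.< p ℚ.* q
ℚ-*-positive {p} {q} 0<p 0<q =
  subst (ℚ._< p ℚ.* q) (ℚ.*-zeroʳ p) (ℚ.*-monoʳ-<-pos p {{ℚ.positive 0<p}} 0<q)

ρ-double : ∀ {i} → 0ℤ < i → ρ (i + i) ℚ.+ ρ (i + i) ≡ ρ i
ρ-double {i} 0<i = sym (ρ-unique 0<i (begin
  fromℤ i ℚ.* (ρ (i + i) ℚ.+ ρ (i + i))       ≡⟨ lemma (fromℤ i) (ρ (i + i)) ⟩
  (fromℤ i ℚ.+ fromℤ i) ℚ.* ρ (i + i)         ≡⟨ cong (ℚ._* ρ (i + i)) (fromℤ-+ i i) ⟨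
  fromℤ (i + i) ℚ.* ρ (i + i)                 ≡⟨ ρ-inverse (ℤ.+-mono-< 0<i 0<i) ⟩
  1ℚ                                          ∎))
  where
  open ≡-Reasoning
  lemma : ∀ x r → x ℚ.* (r ℚ.+ r) ≡ (x ℚ.+ x) ℚ.* r
  lemma = solve-∀ ℚ-ring

-- Multiply `i < j` by the positive number `ρ i ℚ.* ρ j`.
ρ-anti-mono-< : ∀ {i j} → 0ℤ < i → i < j → ρ j ℚ.< ρ i
ρ-anti-mono-< {i} {j} 0<i i<j =
  subst₂ ℚ._<_ (cancel (fromℤ i) (ρ i) (ρ j) (ρ-inverse 0<i)) (trans (cong (fromℤ j ℚ.*_) (ℚ.*-comm (ρ i) (ρ j))) (cancel (fromℤ j) (ρ j) (ρ i) (ρ-inverse 0<j)))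
    (ℚ.*-monoˡ-<-pos (ρ i ℚ.* ρ j) {{ℚ.positive (ℚ-*-positive (ρ-positive 0<i) (ρ-positive 0<j))}} (fromℤ-mono-< i<j))
  where
  0<j = ℤ.<-trans 0<i i<j
  cancel : ∀ x r s → x ℚ.* r ≡ 1ℚ → x ℚ.* (r ℚ.* s) ≡ s
  cancel x r s eq = trans (sym (ℚ.*-assoc x r s)) (trans (cong (ℚ._* s) eq) (ℚ.*-identityˡ s))

ρ-anti-mono-≤ : ∀ {i j} → 0ℤ < i → i ≤ j → ρ j ℚ.≤ ρ i
ρ-anti-mono-≤ {i} {j} 0<i i≤j with i ℤ.≟ j
... | yes refl = ℚ.≤-refl
... | no  i≢j  = ℚ.<⇒≤ (ρ-anti-mono-< 0<i (ℤ.≤∧≢⇒< i≤j i≢j))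

/≡*ρ : ∀ p q .{{_ : NonZero q}} → p / q ≡ fromℤ p ℚ.* ρ (+ q)
/≡*ρ p q@(suc q-1) = begin
  p / q                                       ≡⟨ ℚ.*-identityʳ _ ⟨
  p / q ℚ.* 1ℚ                                ≡⟨ cong (p / q ℚ.*_) (ρ-inverse {+ q} (ℤ.+<+ ℕ.z<s)) ⟨
  p / q ℚ.* (fromℤ (+ q) ℚ.* ρ (+ q))         ≡⟨ ℚ.*-assoc (p / q) (fromℤ (+ q)) (ρ (+ q)) ⟨
  p / q ℚ.* fromℤ (+ q) ℚ.* ρ (+ q)           ≡⟨ cong (ℚ._* ρ (+ q)) p/q*q≡p ⟩
  fromℤ p ℚ.* ρ (+ q)                         ∎
  where
  open ≡-Reasoning
  p/q*q≡p : p / q ℚ.* fromℤ (+ q) ≡ fromℤ p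
  p/q*q≡p = ℚ.toℚᵘ-injective
    (ℚᵘ.≃-trans (ℚ.toℚᵘ-homo-* (p / q) (fromℤ (+ q)))
    (ℚᵘ.≃-trans (ℚᵘ.*-cong (ℚ.toℚᵘ-fromℚᵘ (ℚᵘ.mkℚᵘ p q-1)) (toℚᵘ-fromℤ (+ q)))
    (ℚᵘ.≃-trans (ℚᵘ.*≡* (ℤ.*-assoc p (+ q) 1ℤ))
                (ℚᵘ.≃-sym (toℚᵘ-fromℤ p)))))

-- A positive rational has numerator at least 1, hence is at least the reciprocal of its
-- denominator.
ρ<ε : ∀ ε → 0ℚ ℚ.< ε → ∀ {i} → ↧ ε < i → ρ i ℚ.< ε
ρ<ε ε@(ℚ.mkℚ _ _ _) 0<ε {i} ↧ε<i = begin-strict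
  ρ i                           <⟨ ρ-anti-mono-< (ℤ.+<+ ℕ.z<s) ↧ε<i ⟩
  ρ (↧ ε)                       ≡⟨ ℚ.*-identityˡ _ ⟨
  1ℚ ℚ.* ρ (↧ ε)                ≤⟨ ℚ.*-monoʳ-≤-nonNeg (ρ (↧ ε)) {{ℚ.nonNegative (ℚ.<⇒≤ (ρ-positive {↧ ε} (ℤ.+<+ ℕ.z<s)))}} (fromℤ-mono-≤ 1≤↥ε) ⟩
  fromℤ (↥ ε) ℚ.* ρ (↧ ε)       ≡⟨ /≡*ρ (↥ ε) (↧ₙ ε) ⟨
  ↥ ε / ↧ₙ ε                    ≡⟨ ℚ.↥p/↧p≡p ε ⟩
  ε                             ∎
  where
  open ℚ.≤-Reasoning
  1≤↥ε : 1ℤ ≤ ↥ ε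
  1≤↥ε = ℤ.i<j⇒suc[i]≤j (ℤ.positive⁻¹ (↥ ε) {{ℚ.positive 0<ε}})

-- Distances, Cauchy sequences and limits.

∣-∣-comm : ∀ p q → ∣ p ℚ.- q ∣ ≡ ∣ q ℚ.- p ∣
∣-∣-comm p q = trans (sym (ℚ.∣-p∣≡∣p∣ (p ℚ.- q))) (cong ∣_∣ (lemma p q))
  where
  lemma : ∀ p q → ℚ.- (p ℚ.- q) ≡ q ℚ.- p
  lemma = solve-∀ ℚ-ring

∣-∣-between : ∀ {p q d} → p ℚ.≤ q → q ℚ.≤ p ℚ.+ d → ∣ q ℚ.- p ∣ ℚ.≤ d
∣-∣-between {p} {q} {d} p≤q q≤p+d = begin
  ∣ q ℚ.- p ∣          ≡⟨ ℚ.0≤p⇒∣p∣≡p (subst (ℚ._≤ q ℚ.- p) (ℚ.+-inverseʳ p) (ℚ.+-monoˡ-≤ (ℚ.- p) p≤q)) ⟩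
  q ℚ.- p              ≤⟨ ℚ.+-monoˡ-≤ (ℚ.- p) q≤p+d ⟩
  p ℚ.+ d ℚ.- p        ≡⟨ lemma p d ⟩
  d                    ∎
  where
  open ℚ.≤-Reasoning
  lemma : ∀ p d → p ℚ.+ d ℚ.- p ≡ d
  lemma = solve-∀ ℚ-ring

IsCauchy : (ℕ → ℚ) → Set
IsCauchy s = ∀ ε → 0ℚ ℚ.< ε → ∃[ N ] (∀ m n → N ℕ.≤ m → N ℕ.≤ n → ∣ s m ℚ.- s n ∣ ℚ.< ε)

-- The limit is the sequence itself, reals being Cauchy sequences.
cauchy⇒convergent : ∀ s → IsCauchy s → ∃[ α ] (s ⟶ α)
cauchy⇒convergent s s-cauchy = record { approx = s ; cauchy = s-cauchy } , λ ε 0<ε →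
  let N , close = s-cauchy ε 0<ε in N , λ n N≤n → N , λ i N≤i → close n i N≤n N≤i

-- One-sided, as it is applied to nonnegative sequences.
Null : (ℕ → ℚ) → Set
Null δ = ∀ ε → 0ℚ ℚ.< ε → ∃[ N ] (∀ n → N ℕ.≤ n → δ n ℚ.< ε)

module _ (s δ : ℕ → ℚ) (0≤δ : ∀ n → 0ℚ ℚ.≤ δ n)
         (s-step : ∀ n → s n ℚ.≤ s (suc n))
         (s+δ-step : ∀ n → s (suc n) ℚ.+ δ (suc n) ℚ.≤ s n ℚ.+ δ n) where

  private
    s-mono : ∀ n d → s n ℚ.≤ s (d ℕ.+ n)
    s-mono n zero    = ℚ.≤-refl
    s-mono n (suc d) = ℚ.≤-trans (s-mono n d) (s-step (d ℕ.+ n))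

    s+δ-anti : ∀ n d → s (d ℕ.+ n) ℚ.+ δ (d ℕ.+ n) ℚ.≤ s n ℚ.+ δ n
    s+δ-anti n zero    = ℚ.≤-refl
    s+δ-anti n (suc d) = ℚ.≤-trans (s+δ-step (d ℕ.+ n)) (s+δ-anti n d)

    close : ∀ {m n} → n ℕ.≤ m → ∣ s m ℚ.- s n ∣ ℚ.≤ δ n
    close {m} {n} n≤m = subst (λ k → ∣ s k ℚ.- s n ∣ ℚ.≤ δ n) (ℕ.m∸n+n≡m n≤m)
      (∣-∣-between (s-mono n d) (ℚ.≤-trans s≤s+δ (s+δ-anti n d)))
      where
      d = m ℕ.∸ n
      s≤s+δ : s (d ℕ.+ n) ℚ.≤ s (d ℕ.+ n) ℚ.+ δ (d ℕ.+ n)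
      s≤s+δ = subst (ℚ._≤ s (d ℕ.+ n) ℚ.+ δ (d ℕ.+ n)) (ℚ.+-identityʳ (s (d ℕ.+ n))) (ℚ.+-monoʳ-≤ (s (d ℕ.+ n)) (0≤δ (d ℕ.+ n)))

  -- The intervals from `s n` to `s n ℚ.+ δ n` are nested, so every later term stays within `δ n` of
  -- `s n`.
  shrinking⇒cauchy : Null δ → IsCauchy s
  shrinking⇒cauchy δ-null ε 0<ε = N , λ m n N≤m N≤n → cases m n N≤m N≤n (ℕ.≤-total n m)
    where
    N = proj₁ (δ-null ε 0<ε)
    δ<ε = proj₂ (δ-null ε 0<ε)
    cases : ∀ m n → N ℕ.≤ m → N ℕ.≤ n → n ℕ.≤ m ⊎ m ℕ.≤ n → ∣ s m ℚ.- s n ∣ ℚ.< ε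
    cases m n N≤m N≤n (inj₁ n≤m) = ℚ.≤-<-trans (close n≤m) (δ<ε n N≤n)
    cases m n N≤m N≤n (inj₂ m≤n) =
      subst (ℚ._< ε) (∣-∣-comm (s n) (s m)) (ℚ.≤-<-trans (close m≤n) (δ<ε m N≤m))

-- The index `j` may depend on `n` in any way, as long as it can be pushed beyond every `J`; thus
-- one partial sum can serve for two neighbouring convergents.
Shadows : (t s : ℕ → ℚ) → Set
Shadows t s = ∀ ε → 0ℚ ℚ.< ε → ∀ J →
  ∃[ N ] (∀ n → N ℕ.≤ n → ∃[ j ] (J ℕ.≤ j × ∣ t n ℚ.- s j ∣ ℚ.< ε))

shadow-⟶ : ∀ {t s α} → Shadows t s → s ⟶ α → t ⟶ α
shadow-⟶ {t} {s} {α} t~s s⟶α ε 0<ε = N , λ n N≤n →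
  let j , J≤j , t~sⱼ = near n N≤n
      I , sⱼ~α = conv j J≤j
  in I , λ i I≤i → begin-strict
    ∣ t n ℚ.- approx α i ∣                              ≡⟨ cong ∣_∣ (split (t n) (s j) (approx α i)) ⟩
    ∣ (t n ℚ.- s j) ℚ.+ (s j ℚ.- approx α i) ∣          ≤⟨ ℚ.∣p+q∣≤∣p∣+∣q∣ (t n ℚ.- s j) (s j ℚ.- approx α i) ⟩
    ∣ t n ℚ.- s j ∣ ℚ.+ ∣ s j ℚ.- approx α i ∣          <⟨ ℚ.+-mono-< t~sⱼ (sⱼ~α i I≤i) ⟩
    ε ℚ.* ½ ℚ.+ ε ℚ.* ½                                 ≡⟨ ℚ.*-distribˡ-+ ε ½ ½ ⟨
    ε ℚ.* 1ℚ                                            ≡⟨ ℚ.*-identityʳ ε ⟩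
    ε                                                   ∎
  where
  open ℚ.≤-Reasoning
  0<ε/2 = ℚ-*-positive {q = ½} 0<ε (ℚ.positive⁻¹ ½)
  J = proj₁ (s⟶α (ε ℚ.* ½) 0<ε/2)
  conv = proj₂ (s⟶α (ε ℚ.* ½) 0<ε/2)
  N = proj₁ (t~s (ε ℚ.* ½) 0<ε/2 J)
  near = proj₂ (t~s (ε ℚ.* ½) 0<ε/2 J)
  split : ∀ a b c → a ℚ.- c ≡ (a ℚ.- b) ℚ.+ (b ℚ.- c)
  split = solve-∀ ℚ-ring

-- Convergents as quotients of integers.

-- Indexed like den: num a i = p_{i-2}.
num : (ℕ → ℤ) → ℕ → ℤ
num a zero          = 0ℤ
num a (suc zero)    = 1ℤ
num a (suc (suc i)) = a i * num a (suc i) + num a i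

PositiveUpTo : ℕ → (ℕ → ℤ) → Set
PositiveUpTo n a = ∀ j → 1 ℕ.≤ j → j ℕ.≤ n → 0ℤ < a j

-- The recurrence involves two consecutive denominators, so both are carried through the induction;
-- the first bound is weak because q₋₁ = 0.
den-positive : ∀ n {a} → PositiveUpTo n a → 0ℤ ≤ den a (suc n) × 0ℤ < den a (2 ℕ.+ n)
den-positive zero    {a} a>0 = ℤ.≤-refl , subst (0ℤ <_) (sym (lemma (a 0))) (ℤ.+<+ ℕ.z<s)
  where
  lemma : ∀ i → i * 0ℤ + 1ℤ ≡ 1ℤ
  lemma = ℤ-Solver.solve-∀
den-positive (suc n) {a} a>0 =
  let den≥0 , den>0 = den-positive n (λ j 1≤j j≤n → a>0 j 1≤j (ℕ.m≤n⇒m≤1+n j≤n))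
  in ℤ.<⇒≤ den>0 , ℤ.+-mono-<-≤ (*-positive (a>0 (suc n) (ℕ.s≤s ℕ.z≤n) ℕ.≤-refl) den>0) den≥0

den-cong : ∀ n {a b} → (∀ i → i ℕ.< n → a i ≡ b i) → den a (suc n) ≡ den b (suc n)
den-cong zero          a≗b = refl
den-cong (suc zero)    {a} {b} a≗b = cong (λ z → z * 0ℤ + 1ℤ) (a≗b 0 ℕ.z<s)
den-cong (suc (suc n)) a≗b = cong₂ _+_
  (cong₂ _*_ (a≗b (suc n) ℕ.≤-refl) (den-cong (suc n) (λ i i<n → a≗b i (ℕ.m<n⇒m<1+n i<n))))
  (den-cong n (λ i i<n → a≗b i (ℕ.m<n⇒m<1+n (ℕ.m<n⇒m<1+n i<n))))

cf-cong : ∀ n {a b} → (∀ i → i ℕ.≤ n → a i ≡ b i) → cf a n ≡ cf b n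
cf-cong zero    a≗b = cong fromℤ (a≗b 0 ℕ.z≤n)
cf-cong (suc n) a≗b = cong₂ (λ z r → fromℤ z ℚ.+ recip r)
  (a≗b 0 ℕ.z≤n) (cf-cong n (λ i i≤n → a≗b (suc i) (ℕ.s≤s i≤n)))

-- num and den recurse at the end of the sequence, cf at its front.
den-tail : ∀ a i → den a (suc i) ≡ num (a ∘ suc) i
den-tail a zero          = refl
den-tail a (suc zero)    = lemma (a 0)
  where
  lemma : ∀ i → i * 0ℤ + 1ℤ ≡ 1ℤ
  lemma = ℤ-Solver.solve-∀
den-tail a (suc (suc i)) = cong₂ (λ x y → a (suc i) * x + y) (den-tail a (suc i)) (den-tail a i)

-- Both sides satisfy the same two-term recurrence in `i`.
num-tail : ∀ a i → num a (suc i) ≡ a 0 * num (a ∘ suc) i + den (a ∘ suc) i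
num-tail a zero          = sym (lemma (a 0))
  where
  lemma : ∀ i → i * 0ℤ + 1ℤ ≡ 1ℤ
  lemma = ℤ-Solver.solve-∀
num-tail a (suc zero)    = refl
num-tail a (suc (suc i)) = trans
  (cong₂ (λ x y → a (suc i) * x + y) (num-tail a (suc i)) (num-tail a i))
  (lemma (a 0) (a (suc i)) (num (a ∘ suc) (suc i)) (den (a ∘ suc) (suc i)) (num (a ∘ suc) i) (den (a ∘ suc) i))
  where
  lemma : ∀ z t n d n′ d′ → t * (z * n + d) + (z * n′ + d′) ≡ z * (t * n + n′) + (t * d + d′)
  lemma = ℤ-Solver.solve-∀

-- Induction from the front: if the shifted sequence has the value N / D, the whole has the value a₀
-- + D / N = (a₀ N + D) / N, which `num-tail` and `den-tail` recognise as the next convergent.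
cf≡num*ρden : ∀ n {a} → PositiveUpTo n a → cf a n ≡ fromℤ (num a (2 ℕ.+ n)) ℚ.* ρ (den a (2 ℕ.+ n))
cf≡num*ρden zero {a} _ = begin
  fromℤ (a 0)                                                ≡⟨ ℚ.*-identityʳ _ ⟨
  fromℤ (a 0) ℚ.* ρ 1ℤ                                       ≡⟨ cong₂ (λ n d → fromℤ n ℚ.* ρ d) (n≡ (a 0)) (d≡ (a 0)) ⟩
  fromℤ (a 0 * 1ℤ + 0ℤ) ℚ.* ρ (a 0 * 0ℤ + 1ℤ)                ∎
  where
  open ≡-Reasoning
  n≡ : ∀ i → i ≡ i * 1ℤ + 0ℤ
  n≡ = ℤ-Solver.solve-∀
  d≡ : ∀ i → 1ℤ ≡ i * 0ℤ + 1ℤ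
  d≡ = ℤ-Solver.solve-∀
cf≡num*ρden (suc n) {a} a>0 = begin
  fromℤ (a 0) ℚ.+ recip (cf a′ n)                            ≡⟨ cong (λ r → fromℤ (a 0) ℚ.+ recip r) cf≡ ⟩
  fromℤ (a 0) ℚ.+ recip (fromℤ N ℚ.* ρ D)                    ≡⟨ cong (fromℤ (a 0) ℚ.+_) (recip-unique (ℚ-*-positive (fromℤ-mono-< N>0) (ρ-positive D>0)) inverse) ⟩
  fromℤ (a 0) ℚ.+ fromℤ D ℚ.* ρ N                            ≡⟨ cong (ℚ._+ fromℤ D ℚ.* ρ N) (ℚ.*-identityʳ (fromℤ (a 0))) ⟨
  fromℤ (a 0) ℚ.* 1ℚ ℚ.+ fromℤ D ℚ.* ρ N                     ≡⟨ cong (λ z → fromℤ (a 0) ℚ.* z ℚ.+ fromℤ D ℚ.* ρ N) (ρ-inverse N>0) ⟨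
  fromℤ (a 0) ℚ.* (fromℤ N ℚ.* ρ N) ℚ.+ fromℤ D ℚ.* ρ N      ≡⟨ factor (fromℤ (a 0)) (fromℤ N) (ρ N) (fromℤ D) ⟩
  (fromℤ (a 0) ℚ.* fromℤ N ℚ.+ fromℤ D) ℚ.* ρ N              ≡⟨ cong (λ z → (z ℚ.+ fromℤ D) ℚ.* ρ N) (fromℤ-* (a 0) N) ⟨
  (fromℤ (a 0 * N) ℚ.+ fromℤ D) ℚ.* ρ N                      ≡⟨ cong (ℚ._* ρ N) (fromℤ-+ (a 0 * N) D) ⟨
  fromℤ (a 0 * N + D) ℚ.* ρ N                                ≡⟨ cong₂ (λ x y → fromℤ x ℚ.* ρ y) (num-tail a (2 ℕ.+ n)) (den-tail a (2 ℕ.+ n)) ⟨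
  fromℤ (num a (3 ℕ.+ n)) ℚ.* ρ (den a (3 ℕ.+ n))            ∎
  where
  open ≡-Reasoning
  a′ = a ∘ suc
  a′>0 : PositiveUpTo n a′
  a′>0 j 1≤j j≤n = a>0 (suc j) (ℕ.s≤s ℕ.z≤n) (ℕ.s≤s j≤n)
  cf≡ = cf≡num*ρden n a′>0
  N = num a′ (2 ℕ.+ n)
  D = den a′ (2 ℕ.+ n)
  D>0 : 0ℤ < D
  D>0 = proj₂ (den-positive n a′>0)
  -- The numerator of the tail is a denominator of the whole continued fraction, hence positive.
  N>0 : 0ℤ < N
  N>0 = subst (0ℤ <_) (den-tail a (2 ℕ.+ n)) (proj₂ (den-positive (suc n) a>0))
  swap : ∀ x r y s → x ℚ.* r ℚ.* (y ℚ.* s) ≡ x ℚ.* s ℚ.* (y ℚ.* r)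
  swap = solve-∀ ℚ-ring
  factor : ∀ z x r y → z ℚ.* (x ℚ.* r) ℚ.+ y ℚ.* r ≡ (z ℚ.* x ℚ.+ y) ℚ.* r
  factor = solve-∀ ℚ-ring
  inverse : fromℤ N ℚ.* ρ D ℚ.* (fromℤ D ℚ.* ρ N) ≡ 1ℚ
  inverse = trans (swap (fromℤ N) (ρ D) (fromℤ D) (ρ N)) (cong₂ ℚ._*_ (ρ-inverse N>0) (ρ-inverse D>0))

-- Determinants and differences of convergents.

-- In the usual indexing this is p_{i-1} q_{i-2} - p_{i-2} q_{i-1}.
wronskian : (ℕ → ℤ) → ℕ → ℤ
wronskian a i = num a (suc i) * den a i + ℤ.- (num a i * den a (suc i))

wronskian-suc : ∀ a i → wronskian a (suc i) ≡ ℤ.- wronskian a i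
wronskian-suc a i = lemma (a i) (num a (suc i)) (num a i) (den a (suc i)) (den a i)
  where
  lemma : ∀ t n n′ d d′ → (t * n + n′) * d + ℤ.- (n * (t * d + d′)) ≡ ℤ.- (n * d′ + ℤ.- (n′ * d))
  lemma = ℤ-Solver.solve-∀

wronskian-even : ∀ a h → wronskian a (2 ℕ.* h) ≡ 1ℤ
wronskian-even a zero    = refl
wronskian-even a (suc h) = begin
  wronskian a (2 ℕ.* suc h)              ≡⟨ cong (wronskian a) (ℕ.*-suc 2 h) ⟩
  wronskian a (2 ℕ.+ 2 ℕ.* h)            ≡⟨ wronskian-suc a (suc (2 ℕ.* h)) ⟩
  ℤ.- wronskian a (suc (2 ℕ.* h))        ≡⟨ cong ℤ.-_ (wronskian-suc a (2 ℕ.* h)) ⟩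
  ℤ.- ℤ.- wronskian a (2 ℕ.* h)          ≡⟨ ℤ.neg-involutive _ ⟩
  wronskian a (2 ℕ.* h)                  ≡⟨ wronskian-even a h ⟩
  1ℤ                                     ∎
  where open ≡-Reasoning

-- The left side is the numerator of the difference of the convergents with indices `i` and i - 2.
-- After substituting the recurrences for p_i and q_i, the products p_{i-2} q_{i-2} cancel.
wronskian₂ : ∀ a i → num a (2 ℕ.+ i) * den a i + ℤ.- (num a i * den a (2 ℕ.+ i)) ≡ a i * wronskian a i
wronskian₂ a i = lemma (a i) (num a (suc i)) (num a i) (den a (suc i)) (den a i)
  where
  lemma : ∀ t n n′ d d′ → (t * n + n′) * d′ + ℤ.- (n′ * (t * d + d′)) ≡ t * (n * d′ + ℤ.- (n′ * d))
  lemma = ℤ-Solver.solve-∀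

-- Subtraction over a common denominator, arranged to rewrite a convergent as an earlier one plus a
-- determinant over the product of the denominators.
ρ-difference : ∀ i k {j l} → 0ℤ < j → 0ℤ < l →
  fromℤ k ℚ.* ρ l ≡ fromℤ i ℚ.* ρ j ℚ.+ fromℤ (k * j + ℤ.- (i * l)) ℚ.* (ρ j ℚ.* ρ l)
ρ-difference i k {j} {l} 0<j 0<l = sym (begin
  I ℚ.* ρ j ℚ.+ fromℤ (k * j + ℤ.- (i * l)) ℚ.* (ρ j ℚ.* ρ l)
    ≡⟨ cong (λ z → I ℚ.* ρ j ℚ.+ z ℚ.* (ρ j ℚ.* ρ l)) expand ⟩
  I ℚ.* ρ j ℚ.+ (K ℚ.* J ℚ.- I ℚ.* L) ℚ.* (ρ j ℚ.* ρ l)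
    ≡⟨ lemma I J K L (ρ j) (ρ l) ⟩
  I ℚ.* ρ j ℚ.* (1ℚ ℚ.- L ℚ.* ρ l) ℚ.+ K ℚ.* ρ l ℚ.* (J ℚ.* ρ j)
    ≡⟨ cong₂ (λ v w → I ℚ.* ρ j ℚ.* (1ℚ ℚ.- v) ℚ.+ K ℚ.* ρ l ℚ.* w) (ρ-inverse 0<l) (ρ-inverse 0<j) ⟩
  I ℚ.* ρ j ℚ.* (1ℚ ℚ.- 1ℚ) ℚ.+ K ℚ.* ρ l ℚ.* 1ℚ
    ≡⟨ cong₂ ℚ._+_ (ℚ.*-zeroʳ (I ℚ.* ρ j)) (ℚ.*-identityʳ (K ℚ.* ρ l)) ⟩
  0ℚ ℚ.+ K ℚ.* ρ l
    ≡⟨ ℚ.+-identityˡ _ ⟩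
  K ℚ.* ρ l ∎)
  where
  open ≡-Reasoning
  I = fromℤ i
  J = fromℤ j
  K = fromℤ k
  L = fromℤ l
  expand : fromℤ (k * j + ℤ.- (i * l)) ≡ K ℚ.* J ℚ.- I ℚ.* L
  expand = trans (fromℤ-+ (k * j) (ℤ.- (i * l)))
    (cong₂ ℚ._+_ (fromℤ-* k j) (trans (fromℤ-neg (i * l)) (cong ℚ.-_ (fromℤ-* i l))))
  lemma : ∀ I J K L r s → I ℚ.* r ℚ.+ (K ℚ.* J ℚ.- I ℚ.* L) ℚ.* (r ℚ.* s)
                        ≡ I ℚ.* r ℚ.* (1ℚ ℚ.- L ℚ.* s) ℚ.+ K ℚ.* s ℚ.* (J ℚ.* r)
  lemma = solve-∀ ℚ-ring

-- Splicing and interleaving sequences.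

private
  variable
    A : Set

prepend : ℕ → (ℕ → A) → (ℕ → A) → ℕ → A
prepend zero    c t i       = t i
prepend (suc n) c t zero    = c zero
prepend (suc n) c t (suc i) = prepend n (c ∘ suc) t i

prepend-< : ∀ n (c t : ℕ → A) i → i ℕ.< n → prepend n c t i ≡ c i
prepend-< (suc n) c t zero    _           = refl
prepend-< (suc n) c t (suc i) (ℕ.s≤s i<n) = prepend-< n (c ∘ suc) t i i<n

prepend-+ : ∀ n (c t : ℕ → A) i → prepend n c t (n ℕ.+ i) ≡ t i
prepend-+ zero    c t i = refl
prepend-+ (suc n) c t i = prepend-+ n (c ∘ suc) t i

prepend-all : ∀ {P : A → Set} n {c t : ℕ → A} →
  (∀ i → i ℕ.< n → P (c i)) → (∀ i → P (t i)) → ∀ i → P (prepend n c t i)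
prepend-all zero    Pc Pt i       = Pt i
prepend-all (suc n) Pc Pt zero    = Pc 0 ℕ.z<s
prepend-all {P = P} (suc n) Pc Pt (suc i) = prepend-all {P = P} n (λ i i<n → Pc (suc i) (ℕ.s<s i<n)) Pt i

-- The two arguments trade places at each step, which yields f₀, g₀, f₁, g₁, ....
interleave : (ℕ → A) → (ℕ → A) → ℕ → A
interleave f g zero    = f zero
interleave f g (suc n) = interleave g (f ∘ suc) n

2*suc : ∀ n → 2 ℕ.* suc n ≡ 2 ℕ.+ 2 ℕ.* n
2*suc = ℕ.*-suc 2

2*[+suc] : ∀ k j → 2 ℕ.* (k ℕ.+ suc j) ≡ 2 ℕ.+ 2 ℕ.* (k ℕ.+ j)
2*[+suc] k j = trans (cong (2 ℕ.*_) (ℕ.+-suc k j)) (2*suc (k ℕ.+ j))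

interleave-even : ∀ (f g : ℕ → A) j → interleave f g (2 ℕ.* j) ≡ f j
interleave-even f g zero    = refl
interleave-even f g (suc j) = trans (cong (interleave f g) (2*suc j)) (interleave-even (f ∘ suc) (g ∘ suc) j)

interleave-odd : ∀ (f g : ℕ → A) j → interleave f g (suc (2 ℕ.* j)) ≡ g j
interleave-odd f g j = interleave-even g (f ∘ suc) j

interleave-all : ∀ {P : A → Set} {f g : ℕ → A} →
  (∀ i → P (f i)) → (∀ i → P (g i)) → ∀ i → P (interleave f g i)
interleave-all Pf Pg zero    = Pf zero
interleave-all {P = P} Pf Pg (suc i) = interleave-all {P = P} Pg (Pf ∘ suc) i

halve : ∀ n → ∃[ h ] (n ≡ 2 ℕ.* h ⊎ n ≡ suc (2 ℕ.* h))
halve zero = 0 , inj₁ refl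
halve (suc n) with halve n
... | h , inj₁ n≡2h   = h , inj₂ (cong suc n≡2h)
... | h , inj₂ n≡1+2h = suc h , inj₁ (trans (cong suc n≡1+2h) (sym (2*suc h)))

-- The last denominator of an expansion of a fraction in lowest terms.

1≤ : ∀ {i} → 0ℤ < i → 1ℤ ≤ i
1≤ = ℤ.i<j⇒suc[i]≤j

-- N and D, the numerator and denominator of the 2k-th convergent, satisfy
-- p D = N q, whence q ∣ D.  Multiplying N D′ − N′ D = −1 by q and substituting
-- p D for N q gives D ∣ q.
den-lowest-terms : ∀ k {c p q} .{{_ : NonZero q}} → Coprime p (+ q) → PositiveUpTo (2 ℕ.* k) c →
  p / q ≡ cf c (2 ℕ.* k) → den c (2 ℕ.+ 2 ℕ.* k) ≡ + q
den-lowest-terms k {c} {p} {q@(suc _)} p⊥q c>0 p/q≡cf = begin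
  D              ≡⟨ ℤ.0≤i⇒+∣i∣≡i (ℤ.<⇒≤ D>0) ⟨
  + ℤ.∣ D ∣      ≡⟨ cong +_ (ℕ.∣-antisym D∣q q∣D) ⟩
  + q            ∎
  where
  open ≡-Reasoning
  N = num c (2 ℕ.+ 2 ℕ.* k)
  D = den c (2 ℕ.+ 2 ℕ.* k)
  N′ = num c (suc (2 ℕ.* k))
  D′ = den c (suc (2 ℕ.* k))

  D>0 : 0ℤ < D
  D>0 = proj₂ (den-positive (2 ℕ.* k) c>0)

  q>0 : 0ℤ < + q
  q>0 = ℤ.+<+ ℕ.z<s

  clear : ∀ n d m e → fromℤ n ℚ.* ρ d ≡ fromℤ m ℚ.* ρ e → 0ℤ < d → 0ℤ < e → n * e ≡ m * d
  clear n d m e eq 0<d 0<e = fromℤ-injective (begin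
    fromℤ (n * e)                                      ≡⟨ fromℤ-* n e ⟩
    fromℤ n ℚ.* fromℤ e                                ≡⟨ ℚ.*-identityʳ _ ⟨
    fromℤ n ℚ.* fromℤ e ℚ.* 1ℚ                         ≡⟨ cong (fromℤ n ℚ.* fromℤ e ℚ.*_) (ρ-inverse 0<d) ⟨
    fromℤ n ℚ.* fromℤ e ℚ.* (fromℤ d ℚ.* ρ d)          ≡⟨ swap (fromℤ n) (fromℤ e) (fromℤ d) (ρ d) ⟩
    fromℤ n ℚ.* ρ d ℚ.* (fromℤ e ℚ.* fromℤ d)          ≡⟨ cong (ℚ._* (fromℤ e ℚ.* fromℤ d)) eq ⟩
    fromℤ m ℚ.* ρ e ℚ.* (fromℤ e ℚ.* fromℤ d)          ≡⟨ swap′ (fromℤ m) (ρ e) (fromℤ e) (fromℤ d) ⟩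
    fromℤ m ℚ.* fromℤ d ℚ.* (fromℤ e ℚ.* ρ e)          ≡⟨ cong (fromℤ m ℚ.* fromℤ d ℚ.*_) (ρ-inverse 0<e) ⟩
    fromℤ m ℚ.* fromℤ d ℚ.* 1ℚ                         ≡⟨ ℚ.*-identityʳ _ ⟩
    fromℤ m ℚ.* fromℤ d                                ≡⟨ fromℤ-* m d ⟨
    fromℤ (m * d)                                      ∎)
    where
    swap : ∀ n e d r → n ℚ.* e ℚ.* (d ℚ.* r) ≡ n ℚ.* r ℚ.* (e ℚ.* d)
    swap = solve-∀ ℚ-ring
    swap′ : ∀ m r e d → m ℚ.* r ℚ.* (e ℚ.* d) ≡ m ℚ.* d ℚ.* (e ℚ.* r)
    swap′ = solve-∀ ℚ-ring

  pD≡Nq : p * D ≡ N * + q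
  pD≡Nq = clear p (+ q) N D (trans (sym (/≡*ρ p q)) (trans p/q≡cf (cf≡num*ρden (2 ℕ.* k) c>0))) q>0 D>0

  q∣D : + q ∣ D
  q∣D = ℤ.coprime-divisor (+ q) p D (ℤ.sym {p} {+ q} p⊥q) (Signed.∣⇒∣ᵤ (Signed.divides N pD≡Nq))

  W≡-1 : N * D′ + ℤ.- (N′ * D) ≡ ℤ.- 1ℤ
  W≡-1 = trans (wronskian-suc c (2 ℕ.* k)) (cong ℤ.-_ (wronskian-even c k))

  D∣q : D ∣ + q
  D∣q = Signed.∣⇒∣ᵤ (Signed.divides (N′ * + q + ℤ.- (p * D′)) (begin
    + q                                              ≡⟨ ring₁ (+ q) ⟩
    ℤ.- (ℤ.- 1ℤ * + q)                               ≡⟨ cong (λ w → ℤ.- (w * + q)) W≡-1 ⟨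
    ℤ.- ((N * D′ + ℤ.- (N′ * D)) * + q)              ≡⟨ ring₂ N D′ N′ D (+ q) ⟩
    N′ * + q * D + ℤ.- (N * + q * D′)                ≡⟨ cong (λ z → N′ * + q * D + ℤ.- (z * D′)) pD≡Nq ⟨
    N′ * + q * D + ℤ.- (p * D * D′)                  ≡⟨ ring₃ N′ (+ q) D p D′ ⟩
    (N′ * + q + ℤ.- (p * D′)) * D                    ∎))
    where
    ring₁ : ∀ q → q ≡ ℤ.- (ℤ.- 1ℤ * q)
    ring₁ = ℤ-Solver.solve-∀
    ring₂ : ∀ n d′ n′ d q → ℤ.- ((n * d′ + ℤ.- (n′ * d)) * q) ≡ n′ * q * d + ℤ.- (n * q * d′)
    ring₂ = ℤ-Solver.solve-∀
    ring₃ : ∀ n′ q d p d′ → n′ * q * d + ℤ.- (p * d * d′) ≡ (n′ * q + ℤ.- (p * d′)) * d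
    ring₃ = ℤ-Solver.solve-∀

-- Growth of the recurrences and convergence of the series.

module Recurrences (u x y : ℕ → ℤ) (u>0 : ∀ n → 1 ℕ.≤ n → 0ℤ < u n)
  (y-step : ∀ j → y (suc j) ≡ y j * (1ℤ + u (suc j) * x (suc j)))
  (x-step : ∀ j → x (2 ℕ.+ j) ≡ x (suc j) * y (suc j))
  (y₀>0 : 0ℤ < y 0) (x₁>0 : 0ℤ < x 1) where

  -- The product splits into `y j` and a further positive summand, both at least 1. The strict
  -- bound, not mere positivity, is what makes `x` double at each step.
  y-grows : ∀ j → 0ℤ < y j → 0ℤ < x (suc j) → 1ℤ < y (suc j)
  y-grows j yⱼ>0 xⱼ₊₁>0 = subst (1ℤ <_) (sym (trans (y-step j) (expand (y j) (u (suc j) * x (suc j)))))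
    (ℤ.+-mono-≤-< (1≤ yⱼ>0) (*-positive yⱼ>0 (*-positive (u>0 (suc j) (ℕ.s≤s ℕ.z≤n)) xⱼ₊₁>0)))
    where
    expand : ∀ y w → y * (1ℤ + w) ≡ y + y * w
    expand = ℤ-Solver.solve-∀

  -- A joint induction, since each recurrence involves both sequences.
  positive : ∀ j → 0ℤ < y j × 0ℤ < x (suc j)
  positive zero    = y₀>0 , x₁>0
  positive (suc j) = y>0 , subst (0ℤ <_) (sym (x-step j)) (*-positive x>0 y>0)
    where
    x>0 = proj₂ (positive j)
    y>0 = ℤ.<-trans (ℤ.+<+ ℕ.z<s) (y-grows j (proj₁ (positive j)) x>0)

  y>0 : ∀ j → 0ℤ < y j
  y>0 = proj₁ ∘ positive

  x>0 : ∀ j → 0ℤ < x (suc j)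
  x>0 = proj₂ ∘ positive

  x-doubles : ∀ j → x (suc j) + x (suc j) ≤ x (2 ℕ.+ j)
  x-doubles j = subst₂ _≤_ (double (x (suc j))) (sym (x-step j))
    (ℤ.*-monoˡ-≤-nonNeg (x (suc j)) {{ℤ.nonNegative (ℤ.<⇒≤ (x>0 j))}}
      (ℤ.i<j⇒suc[i]≤j (y-grows j (y>0 j) (x>0 j))))
    where
    double : ∀ i → i * + 2 ≡ i + i
    double = ℤ-Solver.solve-∀

  -- Doubling gives much more, but linear growth suffices to exceed the denominator of any `ε`.
  x-large : ∀ j → + j < x (suc j)
  x-large zero    = x>0 0
  x-large (suc j) = ℤ.<-≤-trans (ℤ.+-mono-≤-< (1≤ (x>0 j)) (x-large j)) (x-doubles j)

  ρx-null : Null (ρ ∘ x ∘ suc)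
  ρx-null ε 0<ε = ↧ₙ ε , λ n N≤n → ρ<ε ε 0<ε (ℤ.≤-<-trans (ℤ.+≤+ N≤n) (x-large n))

  -- The next term of the series equals the next error margin; together they have to fit into the
  -- present margin, for the upper bounds of the partial sums to decrease.
  ρx-halves : ∀ j → ρ (x (2 ℕ.+ j)) ℚ.+ ρ (x (2 ℕ.+ j)) ℚ.≤ ρ (x (suc j))
  ρx-halves j = begin
    ρ (x (2 ℕ.+ j)) ℚ.+ ρ (x (2 ℕ.+ j))        ≤⟨ ℚ.+-mono-≤ anti anti ⟩
    ρ (X + X) ℚ.+ ρ (X + X)                    ≡⟨ ρ-double (x>0 j) ⟩
    ρ X                                        ∎
    where
    open ℚ.≤-Reasoning
    X = x (suc j)
    anti = ρ-anti-mono-≤ (ℤ.+-mono-< (x>0 j) (x>0 j)) (x-doubles j)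

  module _ (r : ℚ) where

    sums : ℕ → ℚ
    sums n = r ℚ.+ ∑< n (λ i → recip (fromℤ (x (2 ℕ.+ i))))

    sums-suc : ∀ n → sums (suc n) ≡ sums n ℚ.+ ρ (x (2 ℕ.+ n))
    sums-suc n = sym (ℚ.+-assoc r (∑< n (λ i → recip (fromℤ (x (2 ℕ.+ i))))) (ρ (x (2 ℕ.+ n))))

    sums-cauchy : IsCauchy sums
    sums-cauchy = shrinking⇒cauchy sums (ρ ∘ x ∘ suc) (λ n → ℚ.<⇒≤ (ρ-positive (x>0 n)))
      (λ n → begin
        sums n                                         ≡⟨ ℚ.+-identityʳ (sums n) ⟨
        sums n ℚ.+ 0ℚ                                  ≤⟨ ℚ.+-monoʳ-≤ (sums n) (ℚ.<⇒≤ (ρ-positive (x>0 (suc n)))) ⟩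
        sums n ℚ.+ ρ (x (2 ℕ.+ n))                     ≡⟨ sums-suc n ⟨
        sums (suc n)                                   ∎)
      (λ n → begin
        sums (suc n) ℚ.+ ρ (x (2 ℕ.+ n))                              ≡⟨ cong (ℚ._+ ρ (x (2 ℕ.+ n))) (sums-suc n) ⟩
        sums n ℚ.+ ρ (x (2 ℕ.+ n)) ℚ.+ ρ (x (2 ℕ.+ n))                ≡⟨ ℚ.+-assoc (sums n) (ρ (x (2 ℕ.+ n))) (ρ (x (2 ℕ.+ n))) ⟩
        sums n ℚ.+ (ρ (x (2 ℕ.+ n)) ℚ.+ ρ (x (2 ℕ.+ n)))              ≤⟨ ℚ.+-monoʳ-≤ (sums n) (ρx-halves n) ⟩
        sums n ℚ.+ ρ (x (suc n))                                      ∎)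
      ρx-null
      where open ℚ.≤-Reasoning

    -- Comparison of the convergents with the partial sums.

    module Convergents (k : ℕ) (a : ℕ → ℤ) (a>0 : ∀ j → 1 ℕ.≤ j → 0ℤ < a j)
      (a-even : ∀ j → a (2 ℕ.* (k ℕ.+ suc j)) ≡ x (suc j))
      (a-odd : ∀ j → a (suc (2 ℕ.* (k ℕ.+ suc j))) ≡ u (2 ℕ.+ j) * y (suc j))
      (cf₀ : cf a (2 ℕ.* k) ≡ r)
      (den₀ : den a (2 ℕ.+ 2 ℕ.* k) ≡ x 1)
      (den₁ : den a (3 ℕ.+ 2 ℕ.* k) + 1ℤ ≡ y 1) where

      -- The partial quotient a_{E+2} equals the denominator q_E, so q_{E+2} = x_{j+1} (q_{E+1} + 1)
      -- = x_{j+1} y_{j+1}. Likewise q_{E+3} + 1 = u_{j+2} y_{j+1} x_{j+2} + y_{j+1}. The added 1 is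
      -- what lets both recurrences factor.
      dens : ∀ j → den a (2 ℕ.+ 2 ℕ.* (k ℕ.+ j)) ≡ x (suc j)
                 × den a (3 ℕ.+ 2 ℕ.* (k ℕ.+ j)) + 1ℤ ≡ y (suc j)
      dens zero    = subst (λ i → den a (2 ℕ.+ 2 ℕ.* i) ≡ x 1 × den a (3 ℕ.+ 2 ℕ.* i) + 1ℤ ≡ y 1)
        (sym (ℕ.+-identityʳ k)) (den₀ , den₁)
      dens (suc j) = subst (λ i → den a (2 ℕ.+ i) ≡ x (2 ℕ.+ j) × den a (3 ℕ.+ i) + 1ℤ ≡ y (2 ℕ.+ j))
        (sym (2*[+suc] k j)) (even , odd)
        where
        open ≡-Reasoning
        E = 2 ℕ.* (k ℕ.+ j)
        aᵉ : a (2 ℕ.+ E) ≡ x (suc j)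
        aᵉ = trans (cong a (sym (2*[+suc] k j))) (a-even j)
        aᵒ : a (3 ℕ.+ E) ≡ u (2 ℕ.+ j) * y (suc j)
        aᵒ = trans (cong (a ∘ suc) (sym (2*[+suc] k j))) (a-odd j)
        factor : ∀ b d → b * d + b ≡ b * (d + 1ℤ)
        factor = ℤ-Solver.solve-∀
        factor′ : ∀ u y d x → u * y * x + d + 1ℤ ≡ u * y * x + (d + 1ℤ)
        factor′ = ℤ-Solver.solve-∀
        factor″ : ∀ u y x → u * y * x + y ≡ y * (1ℤ + u * x)
        factor″ = ℤ-Solver.solve-∀
        even : den a (4 ℕ.+ E) ≡ x (2 ℕ.+ j)
        even = begin
          a (2 ℕ.+ E) * den a (3 ℕ.+ E) + den a (2 ℕ.+ E)
            ≡⟨ cong₂ (λ b d → b * den a (3 ℕ.+ E) + d) aᵉ (proj₁ (dens j)) ⟩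
          x (suc j) * den a (3 ℕ.+ E) + x (suc j)
            ≡⟨ factor (x (suc j)) (den a (3 ℕ.+ E)) ⟩
          x (suc j) * (den a (3 ℕ.+ E) + 1ℤ)
            ≡⟨ cong (x (suc j) *_) (proj₂ (dens j)) ⟩
          x (suc j) * y (suc j)
            ≡⟨ x-step j ⟨
          x (2 ℕ.+ j) ∎
        odd : den a (5 ℕ.+ E) + 1ℤ ≡ y (2 ℕ.+ j)
        odd = begin
          a (3 ℕ.+ E) * den a (4 ℕ.+ E) + den a (3 ℕ.+ E) + 1ℤ
            ≡⟨ cong₂ (λ b d → b * d + den a (3 ℕ.+ E) + 1ℤ) aᵒ even ⟩
          U * Y * x (2 ℕ.+ j) + den a (3 ℕ.+ E) + 1ℤ
            ≡⟨ factor′ U Y (den a (3 ℕ.+ E)) (x (2 ℕ.+ j)) ⟩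
          U * Y * x (2 ℕ.+ j) + (den a (3 ℕ.+ E) + 1ℤ)
            ≡⟨ cong (λ z → U * Y * x (2 ℕ.+ j) + z) (proj₂ (dens j)) ⟩
          U * Y * x (2 ℕ.+ j) + Y
            ≡⟨ factor″ U Y (x (2 ℕ.+ j)) ⟩
          Y * (1ℤ + U * x (2 ℕ.+ j))
            ≡⟨ y-step (suc j) ⟨
          y (2 ℕ.+ j) ∎
          where
          U = u (2 ℕ.+ j)
          Y = y (suc j)

      fraction : ∀ n → cf a n ≡ fromℤ (num a (2 ℕ.+ n)) ℚ.* ρ (den a (2 ℕ.+ n))
      fraction n = cf≡num*ρden n (λ j 1≤j _ → a>0 j 1≤j)

      den>0 : ∀ n → 0ℤ < den a (2 ℕ.+ n)
      den>0 n = proj₂ (den-positive n (λ j 1≤j _ → a>0 j 1≤j))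

      wronskian≡1 : ∀ h → wronskian a (2 ℕ.+ 2 ℕ.* h) ≡ 1ℤ
      wronskian≡1 h = trans (cong (wronskian a) (sym (2*suc h))) (wronskian-even a (suc h))

      even-convergent : ∀ j → cf a (2 ℕ.* (k ℕ.+ j)) ≡ sums j
      even-convergent zero    = trans (cong (cf a ∘ (2 ℕ.*_)) (ℕ.+-identityʳ k)) (trans cf₀ (sym (ℚ.+-identityʳ r)))
      even-convergent (suc j) = begin
        cf a (2 ℕ.* (k ℕ.+ suc j))
          ≡⟨ cong (cf a) (2*[+suc] k j) ⟩
        cf a (2 ℕ.+ E)
          ≡⟨ fraction (2 ℕ.+ E) ⟩
        fromℤ (num a (4 ℕ.+ E)) ℚ.* ρ D′
          ≡⟨ ρ-difference (num a (2 ℕ.+ E)) (num a (4 ℕ.+ E)) (den>0 E) (den>0 (2 ℕ.+ E)) ⟩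
        fromℤ (num a (2 ℕ.+ E)) ℚ.* ρ D ℚ.+ fromℤ (num a (4 ℕ.+ E) * D + ℤ.- (num a (2 ℕ.+ E) * D′)) ℚ.* (ρ D ℚ.* ρ D′)
          ≡⟨ cong₂ (λ v w → v ℚ.+ fromℤ w ℚ.* (ρ D ℚ.* ρ D′)) (sym (fraction E)) determinant ⟩
        cf a E ℚ.+ fromℤ D ℚ.* (ρ D ℚ.* ρ D′)
          ≡⟨ cong₂ ℚ._+_ (even-convergent j) (sym (ℚ.*-assoc (fromℤ D) (ρ D) (ρ D′))) ⟩
        sums j ℚ.+ fromℤ D ℚ.* ρ D ℚ.* ρ D′
          ≡⟨ cong₂ (λ v d → sums j ℚ.+ v ℚ.* ρ d) (ρ-inverse (den>0 E)) D′≡ ⟩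
        sums j ℚ.+ 1ℚ ℚ.* ρ (x (2 ℕ.+ j))
          ≡⟨ cong (sums j ℚ.+_) (ℚ.*-identityˡ (ρ (x (2 ℕ.+ j)))) ⟩
        sums j ℚ.+ ρ (x (2 ℕ.+ j))
          ≡⟨ sums-suc j ⟨
        sums (suc j) ∎
        where
        open ≡-Reasoning
        E = 2 ℕ.* (k ℕ.+ j)
        D = den a (2 ℕ.+ E)
        D′ = den a (4 ℕ.+ E)
        D′≡ : D′ ≡ x (2 ℕ.+ j)
        D′≡ = trans (cong (den a ∘ (2 ℕ.+_)) (sym (2*[+suc] k j))) (proj₁ (dens (suc j)))
        -- The partial quotient `a (2 ℕ.+ E)` coincides with the denominator `D`, so the gap D / (D
        -- D′) collapses to 1 / D′.
        determinant : num a (4 ℕ.+ E) * D + ℤ.- (num a (2 ℕ.+ E) * D′) ≡ D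
        determinant = begin
          num a (4 ℕ.+ E) * D + ℤ.- (num a (2 ℕ.+ E) * D′)   ≡⟨ wronskian₂ a (2 ℕ.+ E) ⟩
          a (2 ℕ.+ E) * wronskian a (2 ℕ.+ E)                ≡⟨ cong (a (2 ℕ.+ E) *_) (wronskian≡1 (k ℕ.+ j)) ⟩
          a (2 ℕ.+ E) * 1ℤ                                   ≡⟨ ℤ.*-identityʳ _ ⟩
          a (2 ℕ.+ E)                                        ≡⟨ cong a (2*[+suc] k j) ⟨
          a (2 ℕ.* (k ℕ.+ suc j))                            ≡⟨ a-even j ⟩
          x (suc j)                                          ≡⟨ proj₁ (dens j) ⟨
          D                                                  ∎

      odd-convergent : ∀ j → ∣ cf a (suc (2 ℕ.* (k ℕ.+ j))) ℚ.- sums j ∣ ℚ.≤ ρ (x (suc j))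
      odd-convergent j = subst (λ s → ∣ s ℚ.- sums j ∣ ℚ.≤ ρ (x (suc j))) (sym cf≡)
        (∣-∣-between
          (subst (ℚ._≤ sums j ℚ.+ ρ D ℚ.* ρ D′) (ℚ.+-identityʳ (sums j))
            (ℚ.+-monoʳ-≤ (sums j) (ℚ.<⇒≤ (ℚ-*-positive (ρ-positive (den>0 E)) (ρ-positive (den>0 (suc E)))))))
          (ℚ.+-monoʳ-≤ (sums j) gap≤))
        where
        E = 2 ℕ.* (k ℕ.+ j)
        D = den a (2 ℕ.+ E)
        D′ = den a (3 ℕ.+ E)
        cf≡ : cf a (suc E) ≡ sums j ℚ.+ ρ D ℚ.* ρ D′
        cf≡ = begin
          cf a (suc E)
            ≡⟨ fraction (suc E) ⟩
          fromℤ (num a (3 ℕ.+ E)) ℚ.* ρ D′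
            ≡⟨ ρ-difference (num a (2 ℕ.+ E)) (num a (3 ℕ.+ E)) (den>0 E) (den>0 (suc E)) ⟩
          fromℤ (num a (2 ℕ.+ E)) ℚ.* ρ D ℚ.+ fromℤ (wronskian a (2 ℕ.+ E)) ℚ.* (ρ D ℚ.* ρ D′)
            ≡⟨ cong₂ (λ v w → v ℚ.+ fromℤ w ℚ.* (ρ D ℚ.* ρ D′)) (trans (sym (fraction E)) (even-convergent j)) (wronskian≡1 (k ℕ.+ j)) ⟩
          sums j ℚ.+ 1ℚ ℚ.* (ρ D ℚ.* ρ D′)
            ≡⟨ cong (sums j ℚ.+_) (ℚ.*-identityˡ (ρ D ℚ.* ρ D′)) ⟩
          sums j ℚ.+ ρ D ℚ.* ρ D′ ∎
          where open ≡-Reasoning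
        -- As `D′` is at least 1, its reciprocal can be bounded by 1.
        gap≤ : ρ D ℚ.* ρ D′ ℚ.≤ ρ (x (suc j))
        gap≤ = begin
          ρ D ℚ.* ρ D′        ≤⟨ ℚ.*-monoˡ-≤-nonNeg (ρ D) {{ℚ.nonNegative (ℚ.<⇒≤ (ρ-positive (den>0 E)))}}
                                   (ρ-anti-mono-≤ {1ℤ} (ℤ.+<+ ℕ.z<s) (1≤ (den>0 (suc E)))) ⟩
          ρ D ℚ.* 1ℚ          ≡⟨ ℚ.*-identityʳ (ρ D) ⟩
          ρ D                 ≡⟨ cong ρ (proj₁ (dens j)) ⟩
          ρ (x (suc j))       ∎
          where open ℚ.≤-Reasoning

      -- Beyond the starting index, the convergents with indices 2 (k + M + h) and 2 (k + M + h) + 1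
      -- are both compared with the partial sum of index M + h: the first equals it, the second is
      -- within 1 / x_{M+h+1}.
      convergents-shadow-sums : Shadows (cf a) sums
      convergents-shadow-sums ε 0<ε J = 2 ℕ.* (k ℕ.+ M) , λ n N≤n →
        near n (n ℕ.∸ 2 ℕ.* (k ℕ.+ M)) (sym (ℕ.m+[n∸m]≡n N≤n))
        where
        N₀ = proj₁ (ρx-null ε 0<ε)
        -- The summand `J` puts the partial sum beyond the required index, and `N₀` makes the gap
        -- smaller than `ε`.
        M = J ℕ.+ N₀
        index : ∀ h → 2 ℕ.* (k ℕ.+ M) ℕ.+ 2 ℕ.* h ≡ 2 ℕ.* (k ℕ.+ (M ℕ.+ h))
        index h = trans (sym (ℕ.*-distribˡ-+ 2 (k ℕ.+ M) h)) (cong (2 ℕ.*_) (ℕ.+-assoc k M h))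
        ρx<ε : ∀ h → ρ (x (suc (M ℕ.+ h))) ℚ.< ε
        ρx<ε h = proj₂ (ρx-null ε 0<ε) (M ℕ.+ h) (ℕ.≤-trans (ℕ.m≤n+m N₀ J) (ℕ.m≤m+n M h))
        near : ∀ n d → n ≡ 2 ℕ.* (k ℕ.+ M) ℕ.+ d → ∃[ j ] (J ℕ.≤ j × ∣ cf a n ℚ.- sums j ∣ ℚ.< ε)
        near n d n≡ with halve d
        ... | h , d≡ = M ℕ.+ h , ℕ.≤-trans (ℕ.m≤m+n J N₀) (ℕ.m≤m+n M h) , close d≡
          where
          close : d ≡ 2 ℕ.* h ⊎ d ≡ suc (2 ℕ.* h) → ∣ cf a n ℚ.- sums (M ℕ.+ h) ∣ ℚ.< ε
          close (inj₁ d≡2h) = subst (ℚ._< ε)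
            (sym (cong ∣_∣ (trans (cong (ℚ._- sums (M ℕ.+ h)) cf≡) (ℚ.+-inverseʳ (sums (M ℕ.+ h)))))) 0<ε
            where
            cf≡ : cf a n ≡ sums (M ℕ.+ h)
            cf≡ = trans (cong (cf a) (trans n≡ (trans (cong (λ z → 2 ℕ.* (k ℕ.+ M) ℕ.+ z) d≡2h) (index h)))) (even-convergent (M ℕ.+ h))
          close (inj₂ d≡1+2h) = subst (λ i → ∣ cf a i ℚ.- sums (M ℕ.+ h) ∣ ℚ.< ε) (sym n≡′)
            (ℚ.≤-<-trans (odd-convergent (M ℕ.+ h)) (ρx<ε h))
            where
            n≡′ : n ≡ suc (2 ℕ.* (k ℕ.+ (M ℕ.+ h)))
            n≡′ = trans n≡ (trans (cong (λ z → 2 ℕ.* (k ℕ.+ M) ℕ.+ z) d≡1+2h) (trans (ℕ.+-suc _ (2 ℕ.* h)) (cong suc (index h))))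

-- The sequence of partial quotients and the start of the induction.

theorem2p1 :
  (p : ℤ) (q : ℕ) .{{_ : NonZero q}} → Coprime p (+ q) →
  (m : ℤ) → 0ℤ ≤ m →
  (u : ℕ → ℤ) → (∀ n → 1 ℕ.≤ n → 0ℤ < u n) →
  (k : ℕ) (c : ℕ → ℤ) →
  (∀ j → 1 ℕ.≤ j → j ℕ.≤ 2 ℕ.* k → 0ℤ < c j) →
  p / q ≡ cf c (2 ℕ.* k) →
  (x y : ℕ → ℤ) →
  -- den c (2 k + 1) is the denominator of the (2 k - 1)th convergent
  y 0 ≡ m * + q + den c (2 ℕ.* k ℕ.+ 1) + 1ℤ →
  x 1 ≡ + q →
  (∀ j → y (suc j) ≡ y j * (1ℤ + u (suc j) * x (suc j))) →
  (∀ j → 1 ℕ.≤ j → x (suc j) ≡ x j * y j) →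
  let
    partialSum : ℕ → ℚ
    partialSum n = p / q ℚ.+ ∑< n (λ i → recip (fromℤ (x (2 ℕ.+ i))))
  in
  (∃[ α ] (partialSum ⟶ α)) ×
  (∀ α → partialSum ⟶ α →
    ∃[ a ] ( (∀ i → i ℕ.≤ 2 ℕ.* k → a i ≡ c i)
           × a (2 ℕ.* k ℕ.+ 1) ≡ m + u 1 * y 0
           × (∀ j → 1 ℕ.≤ j → a (2 ℕ.* k ℕ.+ 2 ℕ.* j) ≡ x j)
           × (∀ j → 1 ℕ.≤ j → a (2 ℕ.* k ℕ.+ 2 ℕ.* j ℕ.+ 1) ≡ u (suc j) * y j)
           × HasExpansion α a))
theorem2p1 p q@(suc _) p⊥q m m≥0 u u>0 k c c>0 p/q≡cf x y y₀≡ x₁≡q y-step x-step =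
  cauchy⇒convergent (sums (p / q)) (sums-cauchy (p / q)) ,
  λ α sums⟶α → a , a-initial , a-next , a-even , a-odd ,
    a>0 , shadow-⟶ {cf a} {sums (p / q)} {α} convergents-shadow-sums sums⟶α
  where
  d = den c (suc (2 ℕ.* k))

  y₀≡′ : y 0 ≡ m * + q + d + 1ℤ
  y₀≡′ = trans y₀≡ (cong (λ i → m * + q + den c i + 1ℤ) (ℕ.+-comm (2 ℕ.* k) 1))

  -- Positivity comes from the summand 1: both `m` and `d` can vanish, the latter for k = 0, where
  -- it is q₋₁.
  y₀>0 : 0ℤ < y 0
  y₀>0 = subst (0ℤ <_) (sym y₀≡′)
    (ℤ.+-mono-≤-< (ℤ.+-mono-≤ (*-nonNegative m≥0 (ℤ.+≤+ ℕ.z≤n)) (proj₁ (den-positive (2 ℕ.* k) c>0)))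
      (ℤ.+<+ ℕ.z<s))

  open Recurrences u x y u>0 y-step (λ j → x-step (suc j) (ℕ.s≤s ℕ.z≤n)) y₀>0
    (subst (0ℤ <_) (sym x₁≡q) (ℤ.+<+ ℕ.z<s))

  odds : ℕ → ℤ
  odds zero    = m + u 1 * y 0
  odds (suc j) = u (2 ℕ.+ j) * y (suc j)

  -- Position 0 of `tail` is index 2k + 1 of the expansion, so the odd-indexed partial quotients
  -- come first.
  tail : ℕ → ℤ
  tail = interleave odds (x ∘ suc)

  a : ℕ → ℤ
  a = prepend (suc (2 ℕ.* k)) c tail

  a-initial : ∀ i → i ℕ.≤ 2 ℕ.* k → a i ≡ c i
  a-initial i i≤2k = prepend-< (suc (2 ℕ.* k)) c tail i (ℕ.s≤s i≤2k)

  a-tail : ∀ {i} j → i ≡ suc (2 ℕ.* k) ℕ.+ j → a i ≡ tail j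
  a-tail j i≡ = trans (cong a i≡) (prepend-+ (suc (2 ℕ.* k)) c tail j)

  a-next : a (2 ℕ.* k ℕ.+ 1) ≡ m + u 1 * y 0
  a-next = a-tail 0 (ℕ.+-suc (2 ℕ.* k) 0)

  a-even : ∀ j → 1 ℕ.≤ j → a (2 ℕ.* k ℕ.+ 2 ℕ.* j) ≡ x j
  a-even (suc j) _ = trans
    (a-tail (suc (2 ℕ.* j)) (trans (cong (λ i → 2 ℕ.* k ℕ.+ i) (2*suc j)) (ℕ.+-suc (2 ℕ.* k) (suc (2 ℕ.* j)))))
    (interleave-odd odds (x ∘ suc) j)

  a-odd : ∀ j → 1 ℕ.≤ j → a (2 ℕ.* k ℕ.+ 2 ℕ.* j ℕ.+ 1) ≡ u (suc j) * y j
  a-odd (suc j) _ = trans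
    (a-tail (2 ℕ.* suc j) (ℕ.+-comm (2 ℕ.* k ℕ.+ 2 ℕ.* suc j) 1))
    (interleave-even odds (x ∘ suc) (suc j))

  odds>0 : ∀ j → 0ℤ < odds j
  odds>0 zero    = ℤ.+-mono-≤-< m≥0 (*-positive (u>0 1 ℕ.≤-refl) y₀>0)
  odds>0 (suc j) = *-positive (u>0 (2 ℕ.+ j) (ℕ.s≤s ℕ.z≤n)) (y>0 (suc j))

  a>0 : ∀ j → 1 ℕ.≤ j → 0ℤ < a j
  -- At a successor index `prepend` has already passed `c 0`, which may be negative; 2k terms of `c`
  -- remain.
  a>0 (suc j) _ = prepend-all {P = 0ℤ <_} (2 ℕ.* k) (λ i i<2k → c>0 (suc i) (ℕ.s≤s ℕ.z≤n) i<2k)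
    (interleave-all {P = 0ℤ <_} odds>0 x>0) j

  cf₀ : cf a (2 ℕ.* k) ≡ p / q
  cf₀ = trans (cf-cong (2 ℕ.* k) a-initial) (sym p/q≡cf)

  -- Lowest terms enter here: equality of values becomes equality of the denominators q_{2k} and q.
  den-a : den a (2 ℕ.+ 2 ℕ.* k) ≡ + q
  den-a = den-lowest-terms k {p = p} p⊥q (λ j 1≤j _ → a>0 j 1≤j) (sym cf₀)

  -- This explains the choice of y₀: in (m + u₁ y₀) q + q_{2k-1} + 1 the terms without u₁ add up to
  -- y₀, and what remains is u₁ y₀ q.
  den₁ : den a (3 ℕ.+ 2 ℕ.* k) + 1ℤ ≡ y 1
  den₁ = begin
    a (suc (2 ℕ.* k)) * den a (2 ℕ.+ 2 ℕ.* k) + den a (suc (2 ℕ.* k)) + 1ℤ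
      ≡⟨ cong (λ z → z * den a (2 ℕ.+ 2 ℕ.* k) + den a (suc (2 ℕ.* k)) + 1ℤ)
           (a-tail 0 (sym (ℕ.+-identityʳ (suc (2 ℕ.* k))))) ⟩
    (m + u 1 * y 0) * den a (2 ℕ.+ 2 ℕ.* k) + den a (suc (2 ℕ.* k)) + 1ℤ
      ≡⟨ cong₂ (λ v w → (m + u 1 * y 0) * v + w + 1ℤ) den-a
           (den-cong (2 ℕ.* k) (λ i i<2k → a-initial i (ℕ.<⇒≤ i<2k))) ⟩
    (m + u 1 * y 0) * + q + d + 1ℤ
      ≡⟨ regroup m (u 1) (y 0) (+ q) d ⟩
    m * + q + d + 1ℤ + u 1 * y 0 * + q
      ≡⟨ cong (_+ u 1 * y 0 * + q) y₀≡′ ⟨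
    y 0 + u 1 * y 0 * + q
      ≡⟨ factor (y 0) (u 1) (+ q) ⟩
    y 0 * (1ℤ + u 1 * + q)
      ≡⟨ cong (λ z → y 0 * (1ℤ + u 1 * z)) x₁≡q ⟨
    y 0 * (1ℤ + u 1 * x 1)
      ≡⟨ y-step 0 ⟨
    y 1 ∎
    where
    open ≡-Reasoning
    regroup : ∀ m u y q d → (m + u * y) * q + d + 1ℤ ≡ m * q + d + 1ℤ + u * y * q
    regroup = ℤ-Solver.solve-∀
    factor : ∀ y u q → y + u * y * q ≡ y * (1ℤ + u * q)
    factor = ℤ-Solver.solve-∀

  2*-+ : ∀ j → 2 ℕ.* (k ℕ.+ j) ≡ 2 ℕ.* k ℕ.+ 2 ℕ.* j
  2*-+ = ℕ.*-distribˡ-+ 2 k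

  open Convergents (p / q) k a a>0
    (λ j → trans (cong a (2*-+ (suc j))) (a-even (suc j) (ℕ.s≤s ℕ.z≤n)))
    (λ j → trans (cong a (trans (cong suc (2*-+ (suc j))) (ℕ.+-comm 1 (2 ℕ.* k ℕ.+ 2 ℕ.* suc j))))
      (a-odd (suc j) (ℕ.s≤s ℕ.z≤n)))
    cf₀ (trans den-a (sym x₁≡q)) den₁
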